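{- Let $G$ be a maximally edge-connected graph of order $m\geq 3$, and let $n\geq 4$. If $$\min\{\,n^2\delta(G),\ (n-1)(m+2e(G))\,\}\geq 3n\delta(G)+3n-9,$$ then $G\boxtimes K_n$ is maximally 3-restricted edge-connected.
   Context: Graphs are finite and simple. The order of $G$ is $|V(G)|$, $e(G)=|E(G)|$, and $\delta(G)$ is the minimum degree of $G$. $K_n$ is the complete graph of order $n$. An edge subset $S\subseteq E(G)$ is an edge-cut if $G-S$ is disconnected; the edge-connectivity $\lambda(G)$ is the minimum cardinality of an edge-cut. $G$ is maximally edge-connected if $\lambda(G)=\delta(G)$. An edge subset $S\subseteq E(G)$ is a 3-restricted edge-cut if $G-S$ is disconnected and each component of $G-S$ has at least three vertices. $\lambda_3(G)$ is the minimum cardinality of a 3-restricted edge-cut of $G$ if one exists, and $\lambda_3(G)=+\infty$ otherwise. For $X\subseteq V(G)$, $\partial_G(X)$ is the set of edges with one endpoint in $X$ and the other in $V(G)\setminus X$, and $\xi_3(G)=\min\{|\partial_G(X)| : X\subseteq V(G),\ |X|=3,\ G[X]\text{ is connected}\}$. $G$ is maximally 3-restricted edge-connected if $\lambda_3(G)=\xi_3(G)$. The strong product $G\boxtimes H$ has vertex set $V(G)\times V(H)$; two distinct vertices $(x_1,y_1)$, $(x_2,y_2)$ are adjacent iff $x_1=x_2$ and $y_1y_2\in E(H)$, or $y_1=y_2$ and $x_1x_2\in E(G)$, or $x_1x_2\in E(G)$ and $y_1y_2\in E(H)$. -}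

module Defs where

open import Level using (Level; 0ℓ)
open import Data.Nat using (ℕ; _≤_)
open import Data.Fin using (Fin)
import Data.Fin.Properties as Fin
open import Data.List using (List; []; _∷_; _++_; map; length; filter; cartesianProduct; allFin)
open import Data.List.Extrema.Nat using (min)
open import Data.List.Membership.Propositional using (_∈_)
open import Data.List.Membership.Propositional.Properties using (∈-allFin; ∈-cartesianProduct⁺)
open import Data.List.Relation.Unary.Unique.Propositional using (Unique)
import Data.List.Relation.Unary.Unique.Propositional.Properties as Unique
open import Data.Product using (∃-syntax; _×_; _,_; uncurry)
open import Data.Product.Properties using (≡-dec)
open import Data.Sum using (_⊎_; inj₁; inj₂)
import Data.Sum as Sum
import Data.Product as Product
open import Function using (_∘_)
open import Function.Bundles using (_⇔_)
open import Relation.Binary.Construct.Closure.ReflexiveTransitive using (Star)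
open import Relation.Binary.Core using (Rel; _⇒_)
open import Relation.Binary.Definitions using (Decidable; DecidableEquality; Symmetric)
open import Relation.Binary.PropositionalEquality using (_≡_; _≢_; refl; sym; ≢-sym)
open import Relation.Nullary using (¬_)
open import Relation.Nullary.Construct.Add.Supremum using (_⁺; ⊤⁺; [_])
open import Relation.Nullary.Decidable using (_×-dec_; _⊎-dec_; ¬?)
open import Relation.Unary using (Pred)
import Relation.Unary as U

private
  variable
    ℓ : Level

-- Each unordered pair of distinct positions of the list is listed once.
unorderedPairs : {A : Set} → List A → List (A × A)
unorderedPairs []       = []
unorderedPairs (x ∷ xs) = map (x ,_) xs ++ unorderedPairs xs

record Graph : Set₁ where
  infix 4 _≟_ _~_ _~?_
  field
    Vertex   : Set
    _≟_      : DecidableEquality Vertex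
    vertices : List Vertex
    unique   : Unique vertices
    complete : ∀ v → v ∈ vertices
    _~_      : Rel Vertex 0ℓ
    _~?_     : Decidable _~_
    ~-sym    : Symmetric _~_
    ~-irrefl : ∀ {v} → ¬ (v ~ v)

  order : ℕ
  order = length vertices

  card : {X : Pred Vertex 0ℓ} → U.Decidable X → ℕ
  card X? = length (filter X? vertices)

  degree : Vertex → ℕ
  degree v = card (v ~?_)

  -- Every degree is smaller than the order, so the default value `order` only
  -- matters for the graph without vertices.
  δ : ℕ
  δ = min order (map degree vertices)

  Connected : Set
  Connected = ∀ u v → Star _~_ u v

  -- Connectedness of the subgraph induced by X.
  InducedConnected : Pred Vertex 0ℓ → Set
  InducedConnected X =
    ∀ {u v} → X u → X v → Star (λ a b → X a × X b × a ~ b) u v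

  -- Vertex sets of connected components, as classes of mutually reachable vertices.
  IsComponent : Pred Vertex 0ℓ → Set
  IsComponent X = ∃[ v ] (∀ u → X u ⇔ Star _~_ v u)

-- A set of edges of G, given as a symmetric relation on the vertices.
record EdgeSubset (G : Graph) : Set₁ where
  open Graph G
  field
    Mem     : Rel Vertex 0ℓ
    mem?    : Decidable Mem
    mem-sym : Symmetric Mem
    mem⇒~   : Mem ⇒ _~_

  size : ℕ
  size = length (filter (uncurry mem?) (unorderedPairs vertices))

open EdgeSubset using (size)

E : (G : Graph) → EdgeSubset G
E G = record { Mem = _~_ ; mem? = _~?_ ; mem-sym = ~-sym ; mem⇒~ = λ p → p }
  where open Graph G

e : Graph → ℕ
e G = size (E G)

infixl 6 _-ᴱ_
_-ᴱ_ : (G : Graph) → EdgeSubset G → Graph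
G -ᴱ S = record
  { Vertex   = Vertex
  ; _≟_      = _≟_
  ; vertices = vertices
  ; unique   = unique
  ; complete = complete
  ; _~_      = λ u v → u ~ v × ¬ Mem u v
  ; _~?_     = λ u v → (u ~? v) ×-dec ¬? (mem? u v)
  ; ~-sym    = λ (p , q) → ~-sym p , q ∘ mem-sym
  ; ~-irrefl = λ (p , _) → ~-irrefl p
  }
  where
  open Graph G
  open EdgeSubset S

∂ : (G : Graph) {X : Pred (Graph.Vertex G) 0ℓ} → U.Decidable X → EdgeSubset G
∂ G {X} X? = record
  { Mem     = λ u v → u ~ v × ((X u × ¬ X v) ⊎ (X v × ¬ X u))
  ; mem?    = λ u v → (u ~? v) ×-dec
                      ((X? u ×-dec ¬? (X? v)) ⊎-dec (X? v ×-dec ¬? (X? u)))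
  ; mem-sym = λ (p , q) → ~-sym p , Sum.swap q
  ; mem⇒~   = Product.proj₁
  }
  where open Graph G

IsMinimum : (ℕ → Set ℓ) → ℕ → Set ℓ
IsMinimum P k = P k × (∀ j → P j → k ≤ j)

-- The minimum in ℕ ∪ {+∞}, equal to +∞ (written ⊤⁺) when no number satisfies P.
IsMinimum⁺ : (ℕ → Set ℓ) → ℕ ⁺ → Set ℓ
IsMinimum⁺ P [ k ] = IsMinimum P k
IsMinimum⁺ P ⊤⁺    = ∀ j → ¬ P j

module _ (G : Graph) where
  open Graph G

  IsEdgeCut : EdgeSubset G → Set
  IsEdgeCut S = ¬ Graph.Connected (G -ᴱ S)

  -- λ(G) = k
  IsEdgeConnectivity : ℕ → Set₁
  IsEdgeConnectivity = IsMinimum λ k → ∃[ S ] (IsEdgeCut S × size S ≡ k)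

  MaximallyEdgeConnected : Set₁
  MaximallyEdgeConnected = IsEdgeConnectivity δ

  Is3RestrictedEdgeCut : EdgeSubset G → Set₁
  Is3RestrictedEdgeCut S =
    IsEdgeCut S ×
    (∀ {X : Pred Vertex 0ℓ} (X? : U.Decidable X) →
       Graph.IsComponent (G -ᴱ S) X → 3 ≤ card X?)

  -- λ₃(G) = k
  Isλ₃ : ℕ ⁺ → Set₁
  Isλ₃ = IsMinimum⁺ λ k → ∃[ S ] (Is3RestrictedEdgeCut S × size S ≡ k)

  -- ξ₃(G) = k
  Isξ₃ : ℕ → Set₁
  Isξ₃ = IsMinimum λ k →
    ∃[ X ] ∃[ X? ] (card {X} X? ≡ 3 × InducedConnected X × size (∂ G X?) ≡ k)

  Maximally3RestrictedEdgeConnected : Set₁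
  Maximally3RestrictedEdgeConnected = ∃[ k ] (Isλ₃ [ k ] × Isξ₃ k)

K : ℕ → Graph
K n = record
  { Vertex   = Fin n
  ; _≟_      = Fin._≟_
  ; vertices = allFin n
  ; unique   = Unique.allFin⁺ n
  ; complete = ∈-allFin
  ; _~_      = _≢_
  ; _~?_     = λ i j → ¬? (i Fin.≟ j)
  ; ~-sym    = ≢-sym
  ; ~-irrefl = λ v≢v → v≢v refl
  }

-- Adjacent pairs are automatically distinct, by irreflexivity of the factors.
infixl 7 _⊠_
_⊠_ : Graph → Graph → Graph
G ⊠ H = record
  { Vertex   = G.Vertex × H.Vertex
  ; _≟_      = ≡-dec G._≟_ H._≟_
  ; vertices = cartesianProduct G.vertices H.vertices
  ; unique   = Unique.cartesianProduct⁺ G.unique H.unique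
  ; complete = λ (x , y) → ∈-cartesianProduct⁺ (G.complete x) (H.complete y)
  ; _~_      = λ (x₁ , y₁) (x₂ , y₂) →
                 (x₁ ≡ x₂ × y₁ H.~ y₂) ⊎
                 (y₁ ≡ y₂ × x₁ G.~ x₂) ⊎
                 (x₁ G.~ x₂ × y₁ H.~ y₂)
  ; _~?_     = λ (x₁ , y₁) (x₂ , y₂) →
                 ((x₁ G.≟ x₂) ×-dec (y₁ H.~? y₂)) ⊎-dec
                 (((y₁ H.≟ y₂) ×-dec (x₁ G.~? x₂)) ⊎-dec
                  ((x₁ G.~? x₂) ×-dec (y₁ H.~? y₂)))
  ; ~-sym    = Sum.map (Product.map sym H.~-sym)
                 (Sum.map (Product.map sym G.~-sym) (Product.map G.~-sym H.~-sym))
  ; ~-irrefl = λ { (inj₁ (_ , q))        → H.~-irrefl q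
                 ; (inj₂ (inj₁ (_ , p))) → G.~-irrefl p
                 ; (inj₂ (inj₂ (p , _))) → G.~-irrefl p
                 }
  }
  where
  module G = Graph G
  module H = Graph H

{-# OPTIONS --safe #-}
module Submission where

-- Let X be a vertex set of G ⊠ K n, let a x be the number of its vertices in the fibre
-- over x, and c x = n - a x.  Summing over ordered pairs with y = x or y adjacent to x,
-- |∂ X| = Σ a x * c y.  With D = n (δ + 1), three vertices in a fibre over a vertex of
-- degree δ attain ξ₃ = 3 (D - 3).  A 3-restricted cut contains ∂ X for a component X,
-- so it remains to see |∂ X| ≥ 3 (D - 3) when X and its complement have at least three vertices:
-- * if 0 < a x < n for all x, pairing a x * c y + a y * c x ≥ 2 (n - 1) gives
--   |∂ X| ≥ (n - 1) (m + 2 e(G));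
-- * otherwise some a u = 0, after possibly exchanging X with its complement.  If some
--   a v ≥ 3, then a x * c y ≥ n (a x - a y) and the a v edge-cuts {x | t < a x} of G
--   give |∂ X| ≥ a v * c v + n * a v * δ ≥ 3 (D - 3);
-- * otherwise a ≤ 2, and with s = |X| either s ≤ D - 3 and |∂ X| ≥ s (D - s),
--   or s ≥ 6 and |∂ X| ≥ s (n - 2) (δ + 1).

open import Level using (Level; 0ℓ)
open import Data.Bool using (true; false; if_then_else_)
open import Data.Fin using (Fin; zero; suc; toℕ)
import Data.Fin.Properties as Fin
open import Data.List using (List; []; _∷_; _++_; map; length; filter; cartesianProduct; allFin; upTo)
open import Data.List.Extrema.Nat using (min≤xs; argmin-sel)
open import Data.List.Membership.Propositional using (_∈_; find; lose)
open import Data.List.Membership.Propositional.Properties using (∈-map⁻; ∈-map⁺; ∈-upTo⁻)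
open import Data.List.Properties using (map-cong; map-∘; map-++; map-tabulate; map-applyUpTo; map-upTo; length-tabulate; length-upTo; length-filter)
open import Data.List.Relation.Unary.All as All using (All; []; _∷_)
open import Data.List.Relation.Unary.Any using (here; there; any?)
open import Data.List.Relation.Unary.AllPairs using (_∷_)
open import Data.List.Relation.Unary.Unique.Propositional using (Unique)
open import Data.Nat using (ℕ; zero; suc; _+_; _*_; _∸_; _^_; _⊓_; _≤_; _<_; _≥_; z≤n; s≤s; s≤s⁻¹; _≟_; _≤?_; _<?_)
open import Data.Nat.ListAction using (sum)
open import Data.Nat.ListAction.Properties using (sum-++)
open import Data.Nat.Properties
open import Data.Nat.Tactic.RingSolver using (solve-∀)
open import Data.Product using (∃-syntax; _×_; _,_; proj₂)
open import Data.Sum using (_⊎_; inj₁; inj₂)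
import Data.Sum as Sum
open import Function using (_∘_; id)
open import Function.Bundles using (mk⇔; Equivalence)
open import Relation.Binary.Construct.Closure.ReflexiveTransitive using (Star; ε; _◅_; _◅◅_; reverse)
open import Relation.Binary.Definitions using (DecidableEquality)
open import Relation.Binary.PropositionalEquality using (_≡_; _≢_; refl; sym; trans; cong; cong₂; subst; subst₂)
open import Relation.Nullary using (¬_; Dec; yes; no; does; contradiction)
open import Relation.Nullary.Decidable using (_×-dec_; ¬?; decidable-stable; ¬¬-excluded-middle)
open import Relation.Unary using (Pred)
import Relation.Unary as U
open import Defs

private
  variable
    ℓᵃ ℓᵇ ℓᵖ ℓᵠ ℓʳ : Level
    A : Set ℓᵃ
    B : Set ℓᵇ
    P : Set ℓᵖ
    Q : Set ℓᵠ
    R : Set ℓʳ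

-- Finite sums over lists.

∑ : List A → (A → ℕ) → ℕ
∑ xs f = sum (map f xs)

syntax ∑ xs (λ x → t) = ∑[ x ← xs ] t

∑-cong : {f g : A → ℕ} (xs : List A) → (∀ x → f x ≡ g x) → ∑ xs f ≡ ∑ xs g
∑-cong xs f≗g = cong sum (map-cong f≗g xs)

∑-mono : {f g : A → ℕ} (xs : List A) → (∀ x → f x ≤ g x) → ∑ xs f ≤ ∑ xs g
∑-mono []       f≤g = z≤n
∑-mono (x ∷ xs) f≤g = +-mono-≤ (f≤g x) (∑-mono xs f≤g)

∑-mono-∈ : {f g : A → ℕ} (xs : List A) → (∀ {x} → x ∈ xs → f x ≤ g x) → ∑ xs f ≤ ∑ xs g
∑-mono-∈ []       f≤g = z≤n
∑-mono-∈ (x ∷ xs) f≤g = +-mono-≤ (f≤g (here refl)) (∑-mono-∈ xs (f≤g ∘ there))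

∑-+ : (xs : List A) (f g : A → ℕ) → ∑[ x ← xs ] (f x + g x) ≡ ∑ xs f + ∑ xs g
∑-+ []       f g = refl
∑-+ (x ∷ xs) f g rewrite ∑-+ xs f g = rearrange (f x) (g x) (∑ xs f) (∑ xs g)
  where
  rearrange : ∀ i j k l → (i + j) + (k + l) ≡ (i + k) + (j + l)
  rearrange = solve-∀

∑-*ˡ : (xs : List A) (k : ℕ) (f : A → ℕ) → ∑[ x ← xs ] (k * f x) ≡ k * ∑ xs f
∑-*ˡ []       k f = sym (*-zeroʳ k)
∑-*ˡ (x ∷ xs) k f rewrite ∑-*ˡ xs k f = sym (*-distribˡ-+ k (f x) (∑ xs f))

∑-*ʳ : (xs : List A) (f : A → ℕ) (k : ℕ) → ∑[ x ← xs ] (f x * k) ≡ ∑ xs f * k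
∑-*ʳ xs f k =
  trans (∑-cong xs (λ x → *-comm (f x) k)) (trans (∑-*ˡ xs k f) (*-comm k (∑ xs f)))

∑-const : (xs : List A) (k : ℕ) → ∑[ _ ← xs ] k ≡ length xs * k
∑-const []       k = refl
∑-const (x ∷ xs) k = cong (k +_) (∑-const xs k)

∑-zero : {f : A → ℕ} (xs : List A) → (∀ x → f x ≡ 0) → ∑ xs f ≡ 0
∑-zero []       f≡0 = refl
∑-zero (x ∷ xs) f≡0 rewrite f≡0 x = ∑-zero xs f≡0

∑-swap : (xs : List A) (ys : List B) (f : A → B → ℕ) →
         ∑[ x ← xs ] ∑[ y ← ys ] f x y ≡ ∑[ y ← ys ] ∑[ x ← xs ] f x y
∑-swap []       ys f = sym (∑-zero ys (λ _ → refl))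
∑-swap (x ∷ xs) ys f rewrite ∑-swap xs ys f = sym (∑-+ ys (f x) _)

∑-++ : (xs ys : List A) (f : A → ℕ) → ∑ (xs ++ ys) f ≡ ∑ xs f + ∑ ys f
∑-++ xs ys f = trans (cong sum (map-++ f xs ys)) (sum-++ (map f xs) (map f ys))

∑-map : (g : A → B) (xs : List A) (f : B → ℕ) → ∑ (map g xs) f ≡ ∑ xs (f ∘ g)
∑-map g xs f = cong sum (sym (map-∘ xs))

∑-∈ : {x : A} {xs : List A} (f : A → ℕ) → x ∈ xs → f x ≤ ∑ xs f
∑-∈ f (here refl) = m≤m+n _ _
∑-∈ f (there x∈)  = ≤-trans (∑-∈ f x∈) (m≤n+m _ _)

∑-cartesianProduct : (xs : List A) (ys : List B) (f : A × B → ℕ) →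
                     ∑ (cartesianProduct xs ys) f ≡ ∑[ x ← xs ] ∑[ y ← ys ] f (x , y)
∑-cartesianProduct []       ys f = refl
∑-cartesianProduct (x ∷ xs) ys f =
  trans (∑-++ (map (x ,_) ys) _ f)
        (cong₂ _+_ (∑-map (x ,_) ys f) (∑-cartesianProduct xs ys f))

∑-allFin-suc : (n : ℕ) (f : Fin (suc n) → ℕ) → ∑ (allFin (suc n)) f ≡ f zero + ∑ (allFin n) (f ∘ suc)
∑-allFin-suc n f = cong (λ xs → f zero + sum xs)
  (trans (map-tabulate suc f) (sym (map-tabulate id (f ∘ suc))))

∑-allFin-3+ : (n : ℕ) (f : Fin (3 + n) → ℕ) →
  ∑ (allFin (3 + n)) f
    ≡ f zero + (f (suc zero) + (f (suc (suc zero)) + ∑[ i ← allFin n ] f (suc (suc (suc i)))))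
∑-allFin-3+ n f = trans (∑-allFin-suc (2 + n) f) (cong (f zero +_)
  (trans (∑-allFin-suc (1 + n) (λ i → f (suc i))) (cong (f (suc zero) +_) (∑-allFin-suc n (λ i → f (suc (suc i)))))))

∑-upTo-suc : (n : ℕ) (f : ℕ → ℕ) → ∑ (upTo (suc n)) f ≡ f 0 + ∑ (upTo n) (f ∘ suc)
∑-upTo-suc n f = cong (λ xs → f 0 + sum xs)
  (trans (map-applyUpTo suc f n) (sym (map-upTo (f ∘ suc) n)))

-- Peeling off the head splits the square of ordered pairs into a corner, a row, a column and a
-- smaller square. This turns edge counts, which run over unordered pairs, into double sums over
-- vertices.
∑-unorderedPairs : {A : Set} (xs : List A) (F : A → A → ℕ) →
  ∑[ u ← xs ] ∑[ v ← xs ] F u v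
    ≡ ∑ (unorderedPairs xs) (λ (u , v) → F u v + F v u) + ∑[ u ← xs ] F u u
∑-unorderedPairs []       F = refl
∑-unorderedPairs (x ∷ xs) F
  rewrite ∑-+ xs (λ u → F u x) (λ u → ∑ xs (F u))
        | ∑-unorderedPairs xs F
        | ∑-++ (map (x ,_) xs) (unorderedPairs xs) (λ (u , v) → F u v + F v u)
        | ∑-map (x ,_) xs (λ (u , v) → F u v + F v u)
        | ∑-+ xs (F x) (λ u → F u x)
  = rearrange (F x x) (∑ xs (F x)) (∑[ u ← xs ] F u x) _ _
  where
  rearrange : ∀ i j k l m → (i + j) + (k + (l + m)) ≡ ((j + k) + l) + (i + m)
  rearrange = solve-∀

-- Indicators of decidable propositions.

-- Only the Boolean part is inspected, so that for example the indicators of `suc t <? suc i` and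
-- `t <? i` agree by computation.
𝟙 : Dec P → ℕ
𝟙 P? = if does P? then 1 else 0

𝟙-yes : (P? : Dec P) → P → 𝟙 P? ≡ 1
𝟙-yes (yes _)  _ = refl
𝟙-yes (no ¬pf) pf = contradiction pf ¬pf

𝟙-no : (P? : Dec P) → ¬ P → 𝟙 P? ≡ 0
𝟙-no (yes pf) ¬pf = contradiction pf ¬pf
𝟙-no (no _)   _   = refl

𝟙-mono : (P? : Dec P) (Q? : Dec Q) → (P → Q) → 𝟙 P? ≤ 𝟙 Q?
𝟙-mono (yes pf) Q? f = ≤-reflexive (sym (𝟙-yes Q? (f pf)))
𝟙-mono (no _)   Q? f = z≤n

𝟙-cong : (P? : Dec P) (Q? : Dec Q) → (P → Q) → (Q → P) → 𝟙 P? ≡ 𝟙 Q?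
𝟙-cong P? Q? f g = ≤-antisym (𝟙-mono P? Q? f) (𝟙-mono Q? P? g)

𝟙-× : (P? : Dec P) (Q? : Dec Q) → 𝟙 (P? ×-dec Q?) ≡ 𝟙 P? * 𝟙 Q?
𝟙-× (yes _) (yes _) = refl
𝟙-× (yes _) (no _)  = refl
𝟙-× (no _)  _       = refl

𝟙-¬ : (P? : Dec P) → 𝟙 P? + 𝟙 (¬? P?) ≡ 1
𝟙-¬ (yes _) = refl
𝟙-¬ (no _)  = refl

𝟙-⊎ : (R? : Dec R) (P? : Dec P) (Q? : Dec Q) → (P → ¬ Q) → (R → P ⊎ Q) → (P ⊎ Q → R) →
      𝟙 R? ≡ 𝟙 P? + 𝟙 Q?
𝟙-⊎ R? (yes pf) (yes qf) disjoint _ _ = contradiction qf (disjoint pf)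
𝟙-⊎ R? (yes pf) (no _)   _ _ g = 𝟙-yes R? (g (inj₁ pf))
𝟙-⊎ R? (no _)   (yes qf) _ _ g = 𝟙-yes R? (g (inj₂ qf))
𝟙-⊎ R? (no ¬pf) (no ¬qf) _ f _ = 𝟙-no R? (Sum.[ ¬pf , ¬qf ] ∘ f)

length-filter≡∑𝟙 : {X : Pred A ℓᵖ} (X? : U.Decidable X) (xs : List A) →
                   length (filter X? xs) ≡ ∑[ x ← xs ] 𝟙 (X? x)
length-filter≡∑𝟙 X? []       = refl
length-filter≡∑𝟙 X? (x ∷ xs) with does (X? x)
... | true  = cong suc (length-filter≡∑𝟙 X? xs)
... | false = length-filter≡∑𝟙 X? xs

∑-pick : (_≟ᴬ_ : DecidableEquality A) {xs : List A} → Unique xs → {z : A} → z ∈ xs → (g : A → ℕ) →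
         ∑[ x ← xs ] (𝟙 (x ≟ᴬ z) * g x) ≡ g z
∑-pick {A = A} _≟ᴬ_ (z∉xs ∷ _) {z} (here refl) g
  rewrite 𝟙-yes (z ≟ᴬ z) refl = trans (cong₂ _+_ (*-identityˡ (g z)) (absent z∉xs)) (+-identityʳ (g z))
  where
  absent : {ys : List A} → All (z ≢_) ys → ∑[ y ← ys ] (𝟙 (y ≟ᴬ z) * g y) ≡ 0
  absent []                       = refl
  absent (_∷_ {x = y} z≢y z∉ys) rewrite 𝟙-no (y ≟ᴬ z) (z≢y ∘ sym) = absent z∉ys
∑-pick _≟ᴬ_ (_∷_ {x = x} x∉xs u) {z} (there z∈xs) g
  rewrite 𝟙-no (x ≟ᴬ z) (λ { refl → All.lookup x∉xs z∈xs refl }) = ∑-pick _≟ᴬ_ u z∈xs g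

-- The product is 1 exactly when `j ≤ t < i`. Equality may fail because `t` stops at `m`.
∑-thresholds-≤ : ∀ m i j → ∑[ t ← upTo m ] (𝟙 (t <? i) * 𝟙 (¬? (t <? j))) ≤ i ∸ j
∑-thresholds-≤ zero    i       j       = z≤n
∑-thresholds-≤ (suc m) zero    j       = ≤-trans (≤-reflexive (∑-zero (upTo (suc m)) λ _ → refl)) z≤n
∑-thresholds-≤ (suc m) (suc i) zero
  rewrite ∑-upTo-suc m (λ t → 𝟙 (t <? suc i) * 𝟙 (¬? (t <? 0))) = s≤s (∑-thresholds-≤ m i zero)
∑-thresholds-≤ (suc m) (suc i) (suc j)
  rewrite ∑-upTo-suc m (λ t → 𝟙 (t <? suc i) * 𝟙 (¬? (t <? suc j))) = ∑-thresholds-≤ m i j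

-- Boundaries, degrees and restricted cuts in a finite graph.

module _ (G : Graph) where
  open Graph G using (Vertex; vertices; unique; complete; order; card; degree; δ; _~_; _~?_; ~-sym; ~-irrefl)

  any-vertex? : {X : Pred Vertex 0ℓ} → U.Decidable X → Dec (∃[ v ] X v)
  any-vertex? X? with any? X? vertices
  ... | yes some = let (v , _ , Xv) = find some in yes (v , Xv)
  ... | no none  = no λ (v , Xv) → none (lose (complete v) Xv)

  -- Double negation moves past this quantifier because it ranges over a finite list.
  ¬¬-∀ : {X : Pred Vertex 0ℓ} → (∀ v → ¬ ¬ X v) → ¬ ¬ (∀ v → X v)
  ¬¬-∀ {X} ¬¬X ¬∀ = go vertices (λ all → ¬∀ (λ v → All.lookup all (complete v)))
    where
    go : ∀ vs → ¬ ¬ All X vs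
    go []       k = k []
    go (v ∷ vs) k = ¬¬X v λ Xv → go vs λ Xvs → k (Xv ∷ Xvs)

  card-∑ : {X : Pred Vertex 0ℓ} (X? : U.Decidable X) → card X? ≡ ∑[ v ← vertices ] 𝟙 (X? v)
  card-∑ X? = length-filter≡∑𝟙 X? vertices

  card-mono : {X Y : Pred Vertex 0ℓ} (X? : U.Decidable X) (Y? : U.Decidable Y) →
              (∀ v → X v → Y v) → card X? ≤ card Y?
  card-mono X? Y? X⊆Y = subst₂ _≤_ (sym (card-∑ X?)) (sym (card-∑ Y?))
    (∑-mono vertices λ v → 𝟙-mono (X? v) (Y? v) (X⊆Y v))

  size-mono : (S S′ : EdgeSubset G) → (∀ {u v} → EdgeSubset.Mem S u v → EdgeSubset.Mem S′ u v) →
              EdgeSubset.size S ≤ EdgeSubset.size S′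
  size-mono S S′ S⊆S′ = subst₂ _≤_ (sym (length-filter≡∑𝟙 _ pairs)) (sym (length-filter≡∑𝟙 _ pairs))
    (∑-mono pairs λ (u , v) → 𝟙-mono (EdgeSubset.mem? S u v) (EdgeSubset.mem? S′ u v) S⊆S′)
    where pairs = unorderedPairs vertices

  -- Each edge of ∂ X is oriented from X to its complement.
  size-∂ : {X : Pred Vertex 0ℓ} (X? : U.Decidable X) →
    EdgeSubset.size (∂ G X?)
      ≡ ∑[ u ← vertices ] ∑[ v ← vertices ] (𝟙 (u ~? v) * (𝟙 (X? u) * 𝟙 (¬? (X? v))))
  size-∂ {X} X? = trans (length-filter≡∑𝟙 _ pairs) (trans (∑-cong pairs λ (u , v) → oriented u v)
    (sym (trans (∑-unorderedPairs vertices F)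
      (trans (cong (∑ pairs (λ (u , v) → F u v + F v u) +_) (∑-zero vertices diagonal)) (+-identityʳ _)))))
    where
    pairs = unorderedPairs vertices
    F : Vertex → Vertex → ℕ
    F u v = 𝟙 (u ~? v) * (𝟙 (X? u) * 𝟙 (¬? (X? v)))
    diagonal : ∀ u → F u u ≡ 0
    diagonal u rewrite 𝟙-no (u ~? u) ~-irrefl = refl
    oriented : ∀ u v → 𝟙 (EdgeSubset.mem? (∂ G X?) u v) ≡ F u v + F v u
    oriented u v with u ~? v | v ~? u
    ... | yes u~v | no ¬v~u = contradiction (~-sym u~v) ¬v~u
    ... | no ¬u~v | yes v~u = contradiction (~-sym v~u) ¬u~v
    ... | no _    | no _    = refl
    ... | yes _   | yes _   with X? u | X? v
    ...   | yes _ | yes _ = refl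
    ...   | yes _ | no _  = refl
    ...   | no _  | yes _ = refl
    ...   | no _  | no _  = refl

  handshake : ∑ vertices degree ≡ 2 * e G
  handshake = trans (∑-cong vertices λ u → card-∑ (u ~?_)) (trans (∑-unorderedPairs vertices F)
    (trans (cong₂ _+_ (∑-cong pairs λ (u , v) → twice u v) (∑-zero vertices λ u → 𝟙-no (u ~? u) ~-irrefl))
    (trans (+-identityʳ _) (trans (∑-*ˡ pairs 2 _) (cong (2 *_) (sym (length-filter≡∑𝟙 _ pairs)))))))
    where
    pairs = unorderedPairs vertices
    F : Vertex → Vertex → ℕ
    F u v = 𝟙 (u ~? v)
    twice : ∀ u v → F u v + F v u ≡ 2 * F u v
    twice u v rewrite 𝟙-cong (v ~? u) (u ~? v) ~-sym ~-sym = cong (F u v +_) (sym (+-identityʳ _))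

  δ≤degree : ∀ v → δ ≤ degree v
  δ≤degree v = All.lookup (min≤xs order (map degree vertices)) (∈-map⁺ degree (complete v))

  δ-attained : 0 < order → ∃[ v ] (degree v ≡ δ)
  δ-attained 0<order with argmin-sel id order (map degree vertices)
  ... | inj₂ δ∈ = let (v , _ , δ≡) = ∈-map⁻ degree δ∈ in v , sym δ≡
  -- If the minimum is the default value, any vertex works: `degree v ≤ order = δ ≤ degree v`.
  ... | inj₁ δ≡order = v , ≤-antisym (≤-trans (length-filter (v ~?_) vertices) (≤-reflexive (sym δ≡order))) (δ≤degree v)
    where
    head : (vs : List Vertex) → 0 < length vs → Vertex
    head (v ∷ _) _ = v
    v = head vertices 0<order

  neighbour : ∀ v → 0 < degree v → ∃[ w ] (v ~ w)
  neighbour v 0<d with any-vertex? (v ~?_)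
  ... | yes v~w = v~w
  ... | no none = contradiction (trans (card-∑ (v ~?_)) (∑-zero vertices λ w → 𝟙-no (v ~? w) (none ∘ (w ,_))))
                                (>⇒≢ 0<d)

  -- Membership in `X` is invariant along every path that avoids `∂ X`.
  ∂-isEdgeCut : {X : Pred Vertex 0ℓ} (X? : U.Decidable X) {u v : Vertex} → X u → ¬ X v → IsEdgeCut G (∂ G X?)
  ∂-isEdgeCut {X} X? Xu ¬Xv connected = ¬Xv (invariant (connected _ _) Xu)
    where
    invariant : ∀ {u v} → Star (Graph._~_ (G -ᴱ ∂ G X?)) u v → X u → X v
    invariant ε Xu = Xu
    invariant (_◅_ {j = w} (u~w , ¬mem) path) Xu with X? w
    ... | yes Xw = invariant path Xw
    ... | no ¬Xw = contradiction (u~w , inj₁ (Xu , ¬Xw)) ¬mem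

  -- Reachability in G - S is decided only up to double negation, which suffices
  -- because the conclusion is decidable.
  3-restricted-≥ : {t : ℕ} →
    ({X : Pred Vertex 0ℓ} (X? : U.Decidable X) → 3 ≤ card X? → 3 ≤ card (¬? ∘ X?) → t ≤ EdgeSubset.size (∂ G X?)) →
    (S : EdgeSubset G) → Is3RestrictedEdgeCut G S → t ≤ EdgeSubset.size S
  3-restricted-≥ {t} ∂≥t S (cut , large) = decidable-stable (t ≤? EdgeSubset.size S) λ t≰ →
    ¬¬-∀ (λ u → ¬¬-∀ (λ v → ¬¬-excluded-middle)) λ reach? → cut λ u v → decidable-stable (reach? u v) λ ¬u⟶v →
      t≰ (bound reach? u v ¬u⟶v)
    where
    open EdgeSubset S using (mem?; Mem)
    _⟶_ : Vertex → Vertex → Set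
    _⟶_ = Star (Graph._~_ (G -ᴱ S))
    bound : (∀ u v → Dec (u ⟶ v)) → ∀ u v → ¬ u ⟶ v → t ≤ EdgeSubset.size S
    bound reach? u v ¬u⟶v = ≤-trans
      (∂≥t (reach? u) (large (reach? u) (u , λ _ → mk⇔ id id))
        -- The complement of the component of `u` contains the component of `v`, which supplies its
        -- three vertices.
        (≤-trans (large (reach? v) (v , λ _ → mk⇔ id id))
          (card-mono (reach? v) (¬? ∘ reach? u)
            λ w v⟶w u⟶w → ¬u⟶v (u⟶w ◅◅ reverse (Graph.~-sym (G -ᴱ S)) v⟶w))))
      (size-mono (∂ G (reach? u)) S crossing)
      where
      crossing : ∀ {x y} → EdgeSubset.Mem (∂ G (reach? u)) x y → Mem x y
      crossing {x} {y} (x~y , sides) with mem? x y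
      ... | yes xy∈S = xy∈S
      ... | no xy∉S with sides
      ...   | inj₁ (u⟶x , ¬u⟶y) = contradiction (u⟶x ◅◅ ((x~y , xy∉S) ◅ ε)) ¬u⟶y
      ...   | inj₂ (u⟶y , ¬u⟶x) =
        contradiction (u⟶y ◅◅ (Graph.~-sym (G -ᴱ S) (x~y , xy∉S) ◅ ε)) ¬u⟶x

-- Weighted cuts over closed neighbourhoods.

module _ (G : Graph) where
  open Graph G using (Vertex; vertices; unique; complete; order; degree; δ; _~_; _~?_; ~-sym; ~-irrefl)
    renaming (_≟_ to _≟ⱽ_)

  -- The indicator of the closed neighbourhood of `x`. The two summands are never both 1, and the
  -- additive form lets sums split into a diagonal and an adjacency part.
  ball : Vertex → Vertex → ℕ
  ball x y = 𝟙 (y ≟ⱽ x) + 𝟙 (x ~? y)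

  -- |∂ X| in G ⊠ K n; the factor c y counts the vertices outside X in the fibre over y.
  cutWeight : (a c : Vertex → ℕ) → ℕ
  cutWeight a c = ∑[ x ← vertices ] ∑[ y ← vertices ] (ball x y * (a x * c y))

  -- When `c` counts the vertices outside X, this is the number of neighbours outside X of any
  -- vertex of X in the fibre over `x`.
  ballSum : (Vertex → ℕ) → Vertex → ℕ
  ballSum c x = ∑[ y ← vertices ] (ball x y * c y)

  ball-sym : ∀ x y → ball x y ≡ ball y x
  ball-sym x y = cong₂ _+_ (𝟙-cong (y ≟ⱽ x) (x ≟ⱽ y) sym sym) (𝟙-cong (x ~? y) (y ~? x) ~-sym ~-sym)

  ball≤1 : ∀ x y → ball x y ≤ 1
  ball≤1 x y with y ≟ⱽ x
  ... | yes refl = ≤-reflexive (cong suc (𝟙-no (x ~? x) ~-irrefl))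
  ... | no _     with x ~? y
  ...   | yes _ = ≤-refl
  ...   | no _  = z≤n

  ∑-ball : ∀ x → ∑ vertices (ball x) ≡ 1 + degree x
  ∑-ball x = trans (∑-+ vertices _ _) (cong₂ _+_
    (trans (∑-cong vertices λ y → sym (*-identityʳ _)) (∑-pick _≟ⱽ_ unique (complete x) (λ _ → 1)))
    (sym (card-∑ G (x ~?_))))

  cutWeight-ballSum : ∀ a c → cutWeight a c ≡ ∑[ x ← vertices ] (a x * ballSum c x)
  cutWeight-ballSum a c = ∑-cong vertices λ x → trans
    (∑-cong vertices λ y → rearrange (ball x y) (a x) (c y)) (∑-*ˡ vertices (a x) _)
    where
    rearrange : ∀ i j k → i * (j * k) ≡ j * (i * k)
    rearrange = solve-∀

  -- A set and its complement have the same boundary; this permits exchanging them.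
  cutWeight-comm : ∀ a c → cutWeight a c ≡ cutWeight c a
  cutWeight-comm a c = trans (∑-swap vertices vertices _)
    (∑-cong vertices λ y → ∑-cong vertices λ x → cong₂ _*_ (ball-sym x y) (*-comm (a x) (c y)))

  -- Separates the edges inside fibres from those between fibres, since level cuts of `G` see only
  -- the latter.
  cutWeight-split : ∀ a c → cutWeight a c
    ≡ ∑[ x ← vertices ] (a x * c x) + ∑[ x ← vertices ] ∑[ y ← vertices ] (𝟙 (x ~? y) * (a x * c y))
  cutWeight-split a c = trans (∑-cong vertices λ x → trans
      (∑-cong vertices λ y → *-distribʳ-+ (a x * c y) (𝟙 (y ≟ⱽ x)) (𝟙 (x ~? y)))
      (trans (∑-+ vertices _ _) (cong₂ _+_ (∑-pick _≟ⱽ_ unique (complete x) (λ y → a x * c y)) refl)))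
    (∑-+ vertices _ _)

  cutWeight-≥ : ∀ {a c r} → (∀ x → r ≤ ballSum c x) → ∑ vertices a * r ≤ cutWeight a c
  cutWeight-≥ {a} {c} {r} r≤ = subst₂ _≤_ (∑-*ʳ vertices a r) (sym (cutWeight-ballSum a c))
    (∑-mono vertices λ x → *-monoʳ-≤ (a x) (r≤ x))

  ballSum-≥ : ∀ {c k} → (∀ x → k ≤ c x) → ∀ x → (1 + δ) * k ≤ ballSum c x
  ballSum-≥ {c} {k} k≤c x = begin
    (1 + δ) * k                  ≤⟨ *-monoˡ-≤ k (s≤s (δ≤degree G x)) ⟩
    (1 + degree x) * k           ≡⟨ cong (_* k) (sym (∑-ball x)) ⟩
    ∑ vertices (ball x) * k      ≡⟨ sym (∑-*ʳ vertices (ball x) k) ⟩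
    ∑[ y ← vertices ] (ball x y * k) ≤⟨ ∑-mono vertices (λ y → *-monoʳ-≤ (ball x y) (k≤c y)) ⟩
    ballSum c x                  ∎
    where open ≤-Reasoning

  module _ {n : ℕ} {a c : Vertex → ℕ} (a+c≡n : ∀ x → a x + c x ≡ n) where

    a≤n : ∀ x → a x ≤ n
    a≤n x = subst (a x ≤_) (a+c≡n x) (m≤m+n _ _)

    ballSum-+ : ∀ x → ballSum a x + ballSum c x ≡ (1 + degree x) * n
    ballSum-+ x = trans (sym (∑-+ vertices _ _)) (trans
      (∑-cong vertices λ y → trans (sym (*-distribˡ-+ (ball x y) (a y) (c y))) (cong (ball x y *_) (a+c≡n y)))
      (trans (∑-*ʳ vertices (ball x) n) (cong (_* n) (∑-ball x))))

    -- The closed neighbourhood of `x` carries at least `(1 + δ) * n` vertices of the product, and X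
    -- occupies at most `∑ vertices a` of them.
    ballSum-≥-∸ : ∀ x → (1 + δ) * n ∸ ∑ vertices a ≤ ballSum c x
    ballSum-≥-∸ x = m≤n+o⇒m∸n≤o _ _ (begin
      (1 + δ) * n                 ≤⟨ *-monoˡ-≤ n (s≤s (δ≤degree G x)) ⟩
      (1 + degree x) * n          ≡⟨ sym (ballSum-+ x) ⟩
      ballSum a x + ballSum c x   ≤⟨ +-monoˡ-≤ _ (∑-mono vertices λ y →
                                       ≤-trans (*-monoˡ-≤ (a y) (ball≤1 x y)) (≤-reflexive (*-identityˡ (a y)))) ⟩
      ∑ vertices a + ballSum c x  ∎)
      where open ≤-Reasoning

    -- From `c y = n - a y` the right side is `n * a x - a x * a y`, and `a x ≤ n`. Linearity in the
    -- drop `a x ∸ a y` is what makes it comparable with level cuts.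
    a*c-≥ : ∀ x y → n * (a x ∸ a y) ≤ a x * c y
    a*c-≥ x y = begin
      n * (a x ∸ a y)              ≡⟨ *-distribˡ-∸ n (a x) (a y) ⟩
      n * a x ∸ n * a y            ≤⟨ ∸-monoʳ-≤ (n * a x) (*-monoˡ-≤ (a y) (a≤n x)) ⟩
      n * a x ∸ a x * a y          ≡⟨ cong (_∸ a x * a y) (trans (cong (_* a x) (sym (a+c≡n y))) (rearrange (a y) (c y) (a x))) ⟩
      a x * a y + a x * c y ∸ a x * a y  ≡⟨ m+n∸m≡n (a x * a y) _ ⟩
      a x * c y                    ∎
      where
      open ≤-Reasoning
      rearrange : ∀ i j k → (i + j) * k ≡ k * i + k * j
      rearrange = solve-∀

    -- Opposite orientations of an edge are paired, since 1 ≤ a x * c y alone is too weak.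
    cutWeight-interior : (∀ x → 1 ≤ a x) → (∀ x → 1 ≤ c x) → (n ∸ 1) * (order + 2 * e G) ≤ cutWeight a c
    cutWeight-interior 1≤a 1≤c = *-cancelˡ-≤ 2 (begin
      2 * ((n ∸ 1) * (order + 2 * e G))   ≡⟨ rearrange (n ∸ 1) (order + 2 * e G) ⟩
      (order + 2 * e G) * (2 * (n ∸ 1))   ≡⟨ cong (_* (2 * (n ∸ 1))) (sym ∑∑-ball) ⟩
      (∑[ x ← vertices ] ∑ vertices (ball x)) * (2 * (n ∸ 1)) ≡⟨ sym (∑-*ʳ vertices _ _) ⟩
      ∑[ x ← vertices ] (∑ vertices (ball x) * (2 * (n ∸ 1))) ≡⟨ ∑-cong vertices (λ x → sym (∑-*ʳ vertices _ _)) ⟩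
      ∑[ x ← vertices ] ∑[ y ← vertices ] (ball x y * (2 * (n ∸ 1)))
        ≤⟨ ∑-mono vertices (λ x → ∑-mono vertices λ y → *-monoʳ-≤ (ball x y) (pair x y)) ⟩
      ∑[ x ← vertices ] ∑[ y ← vertices ] (ball x y * (a x * c y + c x * a y))
        ≡⟨ ∑-cong vertices (λ x → trans (∑-cong vertices λ y → *-distribˡ-+ (ball x y) _ _) (∑-+ vertices _ _)) ⟩
      ∑[ x ← vertices ] (∑[ y ← vertices ] (ball x y * (a x * c y)) + ∑[ y ← vertices ] (ball x y * (c x * a y)))
        ≡⟨ ∑-+ vertices _ _ ⟩
      cutWeight a c + cutWeight c a       ≡⟨ cong (cutWeight a c +_) (trans (cutWeight-comm c a) (sym (+-identityʳ _))) ⟩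
      2 * cutWeight a c                   ∎)
      where
      open ≤-Reasoning
      rearrange : ∀ i j → 2 * (i * j) ≡ j * (2 * i)
      rearrange = solve-∀
      ∑∑-ball : ∑[ x ← vertices ] ∑ vertices (ball x) ≡ order + 2 * e G
      ∑∑-ball = trans (∑-cong vertices ∑-ball) (trans (∑-+ vertices (λ _ → 1) degree)
        (cong₂ _+_ (trans (∑-const vertices 1) (*-identityʳ order)) (handshake G)))
      identity : ∀ i j k l → (i + suc j) + (k + suc l) + (i * l + j * k) ≡ suc i * suc l + suc j * suc k
      identity = solve-∀
      -- After lowering all four numbers by one, the two sides differ by `i * l + j * k`.
      product-≥ : ∀ {i j k l} → 1 ≤ i → 1 ≤ j → 1 ≤ k → 1 ≤ l → i + j ≡ n → k + l ≡ n → 2 * (n ∸ 1) ≤ i * l + j * k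
      product-≥ {suc i} {suc j} {suc k} {suc l} _ _ _ _ refl k+l≡ = begin
        2 * (i + suc j)            ≡⟨ cong ((i + suc j) +_) (trans (+-identityʳ _) (sym (suc-injective k+l≡))) ⟩
        (i + suc j) + (k + suc l)  ≤⟨ m≤m+n _ (i * l + j * k) ⟩
        (i + suc j) + (k + suc l) + (i * l + j * k)  ≡⟨ identity i j k l ⟩
        suc i * suc l + suc j * suc k  ∎
      pair : ∀ x y → 2 * (n ∸ 1) ≤ a x * c y + c x * a y
      pair x y = product-≥ (1≤a x) (1≤c x) (1≤a y) (1≤c y) (a+c≡n x) (a+c≡n y)

    -- The sets {x | t < a x} with t < a v are cuts of G separating v from u.
    cutWeight-thresholds :
      (∀ {X : Pred Vertex 0ℓ} (X? : U.Decidable X) {u v} → X u → ¬ X v → δ ≤ EdgeSubset.size (∂ G X?)) →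
      ∀ {u v} → a u ≡ 0 → a v * c v + n * (a v * δ) ≤ cutWeight a c
    cutWeight-thresholds δ≤∂ {u} {v} au≡0 = begin
      a v * c v + n * (a v * δ)
        -- Of the edges inside fibres only those over `v` are kept.
        ≤⟨ +-mono-≤ (∑-∈ (λ x → a x * c x) (complete v)) (*-monoʳ-≤ n descents) ⟩
      ∑[ x ← vertices ] (a x * c x) + n * (∑[ x ← vertices ] ∑[ y ← vertices ] (𝟙 (x ~? y) * (a x ∸ a y)))
        ≡⟨ cong (∑[ x ← vertices ] (a x * c x) +_)
             (sym (trans (∑-cong vertices λ x → ∑-*ˡ vertices n _) (∑-*ˡ vertices n _))) ⟩
      ∑[ x ← vertices ] (a x * c x) + ∑[ x ← vertices ] ∑[ y ← vertices ] (n * (𝟙 (x ~? y) * (a x ∸ a y)))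
        ≤⟨ +-monoʳ-≤ (∑[ x ← vertices ] (a x * c x)) (∑-mono vertices λ x → ∑-mono vertices λ y →
             ≤-trans (≤-reflexive (rearrange n (𝟙 (x ~? y)) (a x ∸ a y))) (*-monoʳ-≤ (𝟙 (x ~? y)) (a*c-≥ x y))) ⟩
      ∑[ x ← vertices ] (a x * c x) + ∑[ x ← vertices ] ∑[ y ← vertices ] (𝟙 (x ~? y) * (a x * c y))
        ≡⟨ sym (cutWeight-split a c) ⟩
      cutWeight a c ∎
      where
      open ≤-Reasoning
      rearrange : ∀ i j k → i * (j * k) ≡ j * (i * k)
      rearrange = solve-∀
      above? : ∀ t → U.Decidable (λ x → t < a x)
      above? t x = t <? a x
      ts = upTo (a v)
      descents : a v * δ ≤ ∑[ x ← vertices ] ∑[ y ← vertices ] (𝟙 (x ~? y) * (a x ∸ a y))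
      descents = begin
        a v * δ          ≡⟨ cong (_* δ) (sym (length-upTo (a v))) ⟩
        length ts * δ    ≡⟨ sym (∑-const ts δ) ⟩
        ∑[ _ ← ts ] δ    ≤⟨ ∑-mono-∈ ts (λ {t} t∈ → δ≤∂ (above? t) {v} {u} (∈-upTo⁻ t∈)
                              (λ t<au → n≮0 (subst (t <_) au≡0 t<au))) ⟩
        ∑[ t ← ts ] EdgeSubset.size (∂ G (above? t))
          ≡⟨ ∑-cong ts (λ t → size-∂ G (above? t)) ⟩
        ∑[ t ← ts ] ∑[ x ← vertices ] ∑[ y ← vertices ] (𝟙 (x ~? y) * (𝟙 (t <? a x) * 𝟙 (¬? (t <? a y))))
          ≡⟨ trans (∑-swap ts vertices _) (∑-cong vertices λ x → trans (∑-swap ts vertices _)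
               (∑-cong vertices λ y → ∑-*ˡ ts (𝟙 (x ~? y)) _)) ⟩
        ∑[ x ← vertices ] ∑[ y ← vertices ] (𝟙 (x ~? y) * (∑[ t ← ts ] (𝟙 (t <? a x) * 𝟙 (¬? (t <? a y)))))
          -- An adjacent pair is crossed from `x` to `y` by at most `a x ∸ a y` of the level sets.
          ≤⟨ ∑-mono vertices (λ x → ∑-mono vertices λ y →
               *-monoʳ-≤ (𝟙 (x ~? y)) (∑-thresholds-≤ (a v) (a x) (a y))) ⟩
        ∑[ x ← vertices ] ∑[ y ← vertices ] (𝟙 (x ~? y) * (a x ∸ a y)) ∎

-- Arithmetic of the three bounds.

-- For `s = 3 + j` and `t = s + 3 + r` the sides differ by `j * r`; this is concavity of
-- `s * (t - s)` between 3 and `t - 3`.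
small-∸ : ∀ {s t} → 3 ≤ s → s + 3 ≤ t → 3 * (t ∸ 3) ≤ s * (t ∸ s)
small-∸ {s} {t} 3≤s s+3≤t with m≤n⇒∃[o]m+o≡n 3≤s | m≤n⇒∃[o]m+o≡n s+3≤t
... | j , refl | r , refl = begin
  3 * (j + 3 + r)              ≤⟨ m≤m+n _ (j * r) ⟩
  3 * (j + 3 + r) + j * r      ≡⟨ identity j r ⟩
  (3 + j) * (3 + r)            ≡⟨ cong ((3 + j) *_) (sym (trans (cong (_∸ (3 + j)) (+-assoc (3 + j) 3 r)) (m+n∸m≡n (3 + j) (3 + r)))) ⟩
  (3 + j) * (3 + j + 3 + r ∸ (3 + j))  ∎
  where
  open ≤-Reasoning
  identity : ∀ j r → 3 * (j + 3 + r) + j * r ≡ (3 + j) * (3 + r)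
  identity = solve-∀

-- Since `t ≥ 2 * 4`, the assumption `t < s + 3` forces `s ≥ 6`, and `6 * (n - 2) ≥ 3 * n` for
-- `n ≥ 4`.
large-∸ : ∀ {s t n δ} → 4 ≤ n → 1 ≤ δ → t ≡ (1 + δ) * n → t < s + 3 → 3 * (t ∸ 3) ≤ s * ((1 + δ) * (n ∸ 2))
large-∸ {s} {t} 4≤n 1≤δ t≡ t<s+3 with m≤n⇒∃[o]m+o≡n 4≤n
large-∸ {s} {t} {δ = δ} 4≤n 1≤δ refl t<s+3 | k , refl = begin
  3 * ((1 + δ) * (4 + k) ∸ 3)    ≤⟨ *-monoʳ-≤ 3 (m∸n≤m ((1 + δ) * (4 + k)) 3) ⟩
  3 * ((1 + δ) * (4 + k))        ≤⟨ m≤m+n _ (3 * ((1 + δ) * k)) ⟩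
  3 * ((1 + δ) * (4 + k)) + 3 * ((1 + δ) * k)  ≡⟨ identity k δ ⟩
  6 * ((1 + δ) * (2 + k))        ≤⟨ *-monoˡ-≤ _ 6≤s ⟩
  s * ((1 + δ) * (2 + k))        ∎
  where
  open ≤-Reasoning
  identity : ∀ k δ → 3 * ((1 + δ) * (4 + k)) + 3 * ((1 + δ) * k) ≡ 6 * ((1 + δ) * (2 + k))
  identity = solve-∀
  6≤s : 6 ≤ s
  6≤s = +-cancelʳ-≤ 3 6 s (≤-trans (s≤s (*-mono-≤ (s≤s 1≤δ) 4≤n)) t<s+3)

-- Put `i = 3 + p`, `j = q` and `δ = 1 + d`: the excess is the polynomial added in `identity`. It
-- vanishes at `i = 3`, so the bound is tight there.
levels-∸ : ∀ {i j n δ} → 3 ≤ i → i + j ≡ n → 1 ≤ δ → 3 * ((1 + δ) * n ∸ 3) ≤ i * j + n * (i * δ)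
levels-∸ {j = q} 3≤i refl 1≤δ with m≤n⇒∃[o]m+o≡n 3≤i | m≤n⇒∃[o]m+o≡n 1≤δ
... | p , refl | d , refl = begin
  3 * ((2 + d) * (3 + p + q) ∸ 3)    ≡⟨ *-distribˡ-∸ 3 ((2 + d) * (3 + p + q)) 3 ⟩
  3 * ((2 + d) * (3 + p + q)) ∸ 9    ≤⟨ m≤n+o⇒m∸n≤o (3 * ((2 + d) * (3 + p + q))) 9 (≤-trans (m≤m+n _ _) (≤-reflexive (identity p q d))) ⟩
  (3 + p) * q + (3 + p + q) * ((3 + p) * (1 + d)) ∎
  where
  open ≤-Reasoning
  identity : ∀ p q d → 3 * ((2 + d) * (3 + p + q)) + (p * p + 2 * (p * q) + d * (p * (3 + p + q)))
                     ≡ 9 + ((3 + p) * q + (3 + p + q) * ((3 + p) * (1 + d)))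
  identity = solve-∀

-- The lower bound for cut weights.

module _ (G : Graph) (mec : MaximallyEdgeConnected G) where
  open Graph G using (Vertex; vertices; order; δ)

  δ≤∂ : {X : Pred Vertex 0ℓ} (X? : U.Decidable X) {u v : Vertex} → X u → ¬ X v → δ ≤ EdgeSubset.size (∂ G X?)
  δ≤∂ X? Xu ¬Xv = proj₂ mec _ (∂ G X? , ∂-isEdgeCut G X? Xu ¬Xv , refl)

  module _ {n : ℕ} (4≤n : 4 ≤ n) (1≤δ : 1 ≤ δ) where

    -- The empty fibre keeps `u` out of every level set of `a`, so a layer of height at least three
    -- yields enough cuts of `G`. Without such a layer, the total `∑ vertices a` decides which
    -- estimate of outside neighbours to use.
    cutWeight-≥-ξ₃-avoiding : {a c : Vertex → ℕ} → (∀ x → a x + c x ≡ n) → 3 ≤ ∑ vertices a →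
      ∀ {u} → a u ≡ 0 → 3 * ((1 + δ) * n ∸ 3) ≤ cutWeight G a c
    cutWeight-≥-ξ₃-avoiding {a} {c} a+c≡n 3≤∑a au≡0
      with any-vertex? G (λ x → 3 ≤? a x) | ∑ vertices a + 3 ≤? (1 + δ) * n
    ... | yes (v , 3≤av) | _ =
      ≤-trans (levels-∸ 3≤av (a+c≡n v) 1≤δ) (cutWeight-thresholds G {a = a} {c} a+c≡n δ≤∂ au≡0)
    ... | no _ | yes small =
      ≤-trans (small-∸ 3≤∑a small) (cutWeight-≥ G (ballSum-≥-∸ G a+c≡n))
    ... | no thin | no large =
      ≤-trans (large-∸ 4≤n 1≤δ refl (≰⇒> large)) (cutWeight-≥ G (ballSum-≥ G n∸2≤c))
      where
      -- All layers have height at most two here.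
      n∸2≤c : ∀ x → n ∸ 2 ≤ c x
      n∸2≤c x = m≤n+o⇒m∸n≤o n 2 (subst (_≤ 2 + c x) (a+c≡n x)
        (+-monoˡ-≤ (c x) (s≤s⁻¹ (≰⇒> λ 3≤ax → thin (x , 3≤ax)))))

    cutWeight-≥-ξ₃ : {a c : Vertex → ℕ} → (∀ x → a x + c x ≡ n) → 3 ≤ ∑ vertices a → 3 ≤ ∑ vertices c →
      3 * ((1 + δ) * n ∸ 3) ≤ (n ∸ 1) * (order + 2 * e G) → 3 * ((1 + δ) * n ∸ 3) ≤ cutWeight G a c
    cutWeight-≥-ξ₃ {a} {c} a+c≡n 3≤∑a 3≤∑c bound
      with any-vertex? G (λ x → a x ≟ 0) | any-vertex? G (λ x → c x ≟ 0)
    ... | yes (u , au≡0) | _ = cutWeight-≥-ξ₃-avoiding a+c≡n 3≤∑a au≡0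
    -- A full fibre is an empty fibre of the complement.
    ... | no _ | yes (u , cu≡0) = ≤-trans
      (cutWeight-≥-ξ₃-avoiding (λ x → trans (+-comm (c x) (a x)) (a+c≡n x)) 3≤∑c cu≡0)
      (≤-reflexive (cutWeight-comm G c a))
    ... | no a≢0 | no c≢0 = ≤-trans bound (cutWeight-interior G a+c≡n
      (λ x → n≢0⇒n>0 λ ax≡0 → a≢0 (x , ax≡0)) (λ x → n≢0⇒n>0 λ cx≡0 → c≢0 (x , cx≡0)))

-- Boundaries in the strong product with a complete graph.

module _ (G : Graph) (n : ℕ) where
  open Graph G using (Vertex; vertices; _~_; _~?_; ~-irrefl) renaming (_≟_ to _≟ⱽ_)
  private
    H = G ⊠ K n
    module H = Graph H

  layer : {X : Pred H.Vertex 0ℓ} → U.Decidable X → Vertex → ℕ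
  layer X? x = ∑[ i ← allFin n ] 𝟙 (X? (x , i))

  layer-¬ : {X : Pred H.Vertex 0ℓ} (X? : U.Decidable X) → ∀ x → layer X? x + layer (¬? ∘ X?) x ≡ n
  layer-¬ X? x = trans (sym (∑-+ (allFin n) _ _)) (trans (∑-cong (allFin n) λ i → 𝟙-¬ (X? (x , i)))
    (trans (∑-const (allFin n) 1) (trans (*-identityʳ _) (length-tabulate {n = n} id))))

  card-layer : {X : Pred H.Vertex 0ℓ} (X? : U.Decidable X) → H.card X? ≡ ∑ vertices (layer X?)
  card-layer X? = trans (card-∑ H X?) (∑-cartesianProduct vertices (allFin n) _)

  ⊠-adjacent : ∀ {x y i j} → (x , i) ≢ (y , j) → x ≡ y ⊎ x ~ y → (x , i) H.~ (y , j)
  ⊠-adjacent u≢v (inj₁ refl) = inj₁ (refl , λ { refl → u≢v refl })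
  ⊠-adjacent {i = i} {j} u≢v (inj₂ x~y) with i Fin.≟ j
  ... | yes i≡j = inj₂ (inj₁ (i≡j , x~y))
  ... | no i≢j  = inj₂ (inj₂ (x~y , i≢j))

  ⊠-adjacent⁻ : ∀ {x y i j} → (x , i) H.~ (y , j) → x ≡ y ⊎ x ~ y
  ⊠-adjacent⁻ (inj₁ (x≡y , _))        = inj₁ x≡y
  ⊠-adjacent⁻ (inj₂ (inj₁ (_ , x~y))) = inj₂ x~y
  ⊠-adjacent⁻ (inj₂ (inj₂ (x~y , _))) = inj₂ x~y

  𝟙-⊠ : ∀ {x y i j} → (x , i) ≢ (y , j) → 𝟙 ((x , i) H.~? (y , j)) ≡ ball G x y
  𝟙-⊠ {x} {y} {i} {j} u≢v = 𝟙-⊎ ((x , i) H.~? (y , j)) (y ≟ⱽ x) (x ~? y) (λ { refl → ~-irrefl })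
    (Sum.map₁ sym ∘ ⊠-adjacent⁻) (⊠-adjacent u≢v ∘ Sum.map₁ sym)

  -- Adjacency of distinct vertices depends only on their first coordinates, so the sums over the
  -- second coordinates factor into layer counts.
  size-∂-⊠ : {X : Pred H.Vertex 0ℓ} (X? : U.Decidable X) →
             EdgeSubset.size (∂ H X?) ≡ cutWeight G (layer X?) (layer (¬? ∘ X?))
  size-∂-⊠ X? = trans (size-∂ H X?) (trans (∑-cartesianProduct vertices (allFin n) _)
    (∑-cong vertices λ x → trans
      (∑-cong (allFin n) λ i → trans (∑-cartesianProduct vertices (allFin n) _)
        (∑-cong vertices λ y → trans (∑-cong (allFin n) λ j → crossing x i y j)
          (trans (∑-*ˡ (allFin n) (ball G x y) _) (cong (ball G x y *_) (∑-*ˡ (allFin n) (𝟙 (X? (x , i))) _)))))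
      (trans (∑-swap (allFin n) vertices _) (∑-cong vertices λ y →
        trans (∑-*ˡ (allFin n) (ball G x y) _) (cong (ball G x y *_) (∑-*ʳ (allFin n) _ (layer (¬? ∘ X?) y)))))))
    where
    crossing : ∀ x i y j → 𝟙 ((x , i) H.~? (y , j)) * (𝟙 (X? (x , i)) * 𝟙 (¬? (X? (y , j))))
                         ≡ ball G x y * (𝟙 (X? (x , i)) * 𝟙 (¬? (X? (y , j))))
    crossing x i y j with X? (x , i) | X? (y , j)
    ... | no _   | _      = trans (*-zeroʳ (𝟙 ((x , i) H.~? (y , j)))) (sym (*-zeroʳ (ball G x y)))
    ... | yes _  | yes _  = trans (*-zeroʳ (𝟙 ((x , i) H.~? (y , j)))) (sym (*-zeroʳ (ball G x y)))
    -- Only here is the weight nonzero, and the two vertices lie on different sides, hence are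
    -- distinct. This matters because `ball G x x` is 1 although no vertex is adjacent to itself.
    ... | yes Xu | no ¬Xv = cong (_* 1) (𝟙-⊠ {i = i} {j} λ { refl → ¬Xv Xu })

-- An extremal triangle inside one fibre.

module _ (G : Graph) (k : ℕ) (x₀ : Graph.Vertex G) where
  open Graph G using (Vertex; vertices; unique; complete; degree; _~_; _~?_; ~-irrefl)
    renaming (_≟_ to _≟ⱽ_)
  private
    n = 4 + k
    H = G ⊠ K n
    module H = Graph H

  -- As `n = 4 + k`, the fibre over `x₀` also has a vertex outside the triangle.
  Triangle : Pred H.Vertex 0ℓ
  Triangle (x , i) = x ≡ x₀ × toℕ i < 3

  triangle? : U.Decidable Triangle
  triangle? (x , i) = (x ≟ⱽ x₀) ×-dec (toℕ i <? 3)

  layer-triangle : ∀ x → layer G n triangle? x ≡ 𝟙 (x ≟ⱽ x₀) * 3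
  layer-triangle x = trans (∑-cong (allFin n) λ i → 𝟙-× (x ≟ⱽ x₀) (toℕ i <? 3))
    (trans (∑-*ˡ (allFin n) (𝟙 (x ≟ⱽ x₀)) below) (cong (𝟙 (x ≟ⱽ x₀) *_) three))
    where
    below : Fin n → ℕ
    below i = 𝟙 (toℕ i <? 3)
    three : ∑ (allFin n) below ≡ 3
    three = trans (∑-allFin-3+ (1 + k) below) (cong (3 +_) (∑-zero (allFin (1 + k)) λ _ → refl))

  ∑-triangle : (g : Vertex → ℕ) → ∑[ x ← vertices ] (layer G n triangle? x * g x) ≡ 3 * g x₀
  ∑-triangle g = trans
    (∑-cong vertices λ x → trans (cong (_* g x) (layer-triangle x)) (*-assoc (𝟙 (x ≟ⱽ x₀)) 3 (g x)))
    (∑-pick _≟ⱽ_ unique (complete x₀) (λ x → 3 * g x))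

  card-triangle : H.card triangle? ≡ 3
  card-triangle = trans (card-layer G n triangle?)
    (trans (∑-cong vertices λ x → sym (*-identityʳ _)) (∑-triangle (λ _ → 1)))

  -- Each of the three vertices is joined to every product vertex over the closed neighbourhood of
  -- `x₀` that lies outside the triangle.
  size-∂-triangle : EdgeSubset.size (∂ H triangle?) ≡ 3 * ((1 + degree x₀) * n ∸ 3)
  size-∂-triangle = trans (size-∂-⊠ G n triangle?) (trans (cutWeight-ballSum G a c) (trans (∑-triangle (ballSum G c))
    (cong (3 *_) (trans (sym (m+n∸m≡n 3 _)) (cong (_∸ 3)
      (trans (cong (_+ ballSum G c x₀) (sym ballSum-a)) (ballSum-+ G (layer-¬ G n triangle?) x₀)))))))
    where
    a = layer G n triangle?
    c = layer G n (¬? ∘ triangle?)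
    ballSum-a : ballSum G a x₀ ≡ 3
    ballSum-a = trans (∑-cong vertices λ y → *-comm (ball G x₀ y) (a y)) (trans (∑-triangle (ball G x₀))
      (cong (3 *_) (cong₂ _+_ (𝟙-yes (x₀ ≟ⱽ x₀) refl) (𝟙-no (x₀ ~? x₀) ~-irrefl))))

  triangle-connected : H.InducedConnected Triangle
  triangle-connected {u} {v} Tu@(refl , _) Tv@(refl , _) with u H.≟ v
  ... | yes refl = ε
  ... | no u≢v   = (Tu , Tv , ⊠-adjacent G n u≢v (inj₁ refl)) ◅ ε

  private
    _⟶_ : H.Vertex → H.Vertex → Set
    _⟶_ = Star (Graph._~_ (H -ᴱ ∂ H triangle?))

  same-side-⟶ : ∀ {x y i j} → x ≡ y ⊎ x ~ y → (Triangle (x , i) → Triangle (y , j)) →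
                (Triangle (y , j) → Triangle (x , i)) → (x , i) ⟶ (y , j)
  same-side-⟶ {x} {y} {i} {j} near into back with (x , i) H.≟ (y , j)
  ... | yes refl = ε
  ... | no u≢v   = (⊠-adjacent G n u≢v near , not-crossing) ◅ ε
    where
    not-crossing : ¬ EdgeSubset.Mem (∂ H triangle?) (x , i) (y , j)
    not-crossing (_ , inj₁ (Tu , ¬Tv)) = ¬Tv (into Tu)
    not-crossing (_ , inj₂ (Tv , ¬Tu)) = ¬Tu (back Tv)

  three-in-layer : {X : Pred H.Vertex 0ℓ} (X? : U.Decidable X) → ∀ x →
    (∀ i → toℕ i < 3 → X (x , i)) → 3 ≤ H.card X?
  three-in-layer X? x X₃ = subst (3 ≤_) (sym (card-layer G n X?))
    (≤-trans (≤-trans three-≤ (≤-reflexive (sym (∑-allFin-3+ (1 + k) inX)))) (∑-∈ (layer G n X?) (complete x)))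
    where
    inX : Fin n → ℕ
    inX i = 𝟙 (X? (x , i))
    rest = ∑[ i ← allFin (1 + k) ] inX (suc (suc (suc i)))
    three-≤ : 3 ≤ inX zero + (inX (suc zero) + (inX (suc (suc zero)) + rest))
    three-≤ rewrite 𝟙-yes (X? (x , zero)) (X₃ zero (s≤s z≤n))
                  | 𝟙-yes (X? (x , suc zero)) (X₃ (suc zero) (s≤s (s≤s z≤n)))
                  | 𝟙-yes (X? (x , suc (suc zero))) (X₃ (suc (suc zero)) (s≤s (s≤s (s≤s z≤n))))
                  = m≤m+n 3 rest

  -- Every component contains the first three vertices of some fibre. A vertex off the fibre of `x₀`
  -- uses its own fibre, and a triangle vertex uses the triangle. The rest of the fibre over `x₀`
  -- may be a single vertex, so from there the path moves to a fibre over a neighbour, which exists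
  -- by positive degree.
  reaches-three : 1 ≤ degree x₀ → ∀ v → ∃[ y ] (∀ i → toℕ i < 3 → v ⟶ (y , i))
  reaches-three 1≤d (x , j) with x ≟ⱽ x₀ | toℕ j <? 3
  ... | no x≢x₀ | _ = x , λ i i<3 →
    same-side-⟶ (inj₁ refl) (λ (x≡x₀ , _) → contradiction x≡x₀ x≢x₀) (λ (x≡x₀ , _) → contradiction x≡x₀ x≢x₀)
  ... | yes x≡x₀ | yes j<3 = x , λ i i<3 →
    same-side-⟶ (inj₁ refl) (λ _ → x≡x₀ , i<3) (λ _ → x≡x₀ , j<3)
  ... | yes refl | no j≮3 with neighbour G x₀ 1≤d
  ...   | y , x₀~y = y , λ i i<3 → same-side-⟶ (inj₂ x₀~y)
    (λ (_ , j<3) → contradiction j<3 j≮3) (λ { (refl , _) → contradiction x₀~y ~-irrefl })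

  ∂-triangle-3-restricted : 1 ≤ degree x₀ → Is3RestrictedEdgeCut H (∂ H triangle?)
  ∂-triangle-3-restricted 1≤d =
    -- The first index beyond the triangle is 3.
    ∂-isEdgeCut H triangle? {x₀ , zero} {x₀ , suc (suc (suc zero))} (refl , s≤s z≤n) (λ (_ , 3<3) → n≮n 3 3<3) ,
    λ X? (v , X⇔) → let (y , v⟶) = reaches-three 1≤d v in
      three-in-layer X? y λ i i<3 → Equivalence.from (X⇔ (y , i)) (v⟶ i i<3)

-- Reading the hypothesis and assembling the theorem.

ξ₃-formula : ∀ n δ → 3 * n * δ + 3 * n ∸ 9 ≡ 3 * ((1 + δ) * n ∸ 3)
ξ₃-formula n δ = trans (cong (_∸ 9) (identity n δ)) (sym (*-distribˡ-∸ 3 ((1 + δ) * n) 3))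
  where
  identity : ∀ n δ → 3 * n * δ + 3 * n ≡ 3 * ((1 + δ) * n)
  identity = solve-∀

-- For `δ = 0` the bound would give `3 * n ∸ 9 ≤ 0`, whereas `n ≥ 4` makes the left side at least 3.
δ-positive : ∀ n δ → 4 ≤ n → 3 * n * δ + 3 * n ∸ 9 ≤ n ^ 2 * δ → 1 ≤ δ
δ-positive n (suc δ) _   _     = s≤s z≤n
δ-positive n zero    4≤n bound =
  contradiction (≤-trans (∸-monoˡ-≤ 9 12≤) (≤-trans bound (≤-reflexive (*-zeroʳ (n ^ 2))))) n≮0
  where
  12≤ : 12 ≤ 3 * n * 0 + 3 * n
  12≤ = ≤-trans (*-monoʳ-≤ 3 4≤n) (m≤n+m (3 * n) (3 * n * 0))

corollary3p1 : (G : Graph) (m n : ℕ) → Graph.order G ≡ m → m ≥ 3 → n ≥ 4 →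
    MaximallyEdgeConnected G →
    (n ^ 2 * Graph.δ G) ⊓ ((n ∸ 1) * (m + 2 * e G)) ≥ (3 * n * Graph.δ G + 3 * n) ∸ 9 →
    Maximally3RestrictedEdgeConnected (G ⊠ K n)
-- Matching on the proof of `n ≥ 4` exposes `n` as `4 + k`, the form in which the triangle is built.
corollary3p1 G m n refl m≥3 n≥4@(s≤s (s≤s (s≤s (s≤s {n = k} z≤n)))) mec bound
  with δ-attained G (≤-trans (s≤s z≤n) m≥3)
... | x₀ , degree≡δ =
  ξ₃ ,
  ((∂ H triangle , ∂-triangle-3-restricted G k x₀ (subst (1 ≤_) (sym degree≡δ) 1≤δ) , size≡ξ₃) ,
   λ { _ (S , restricted , refl) → 3-restricted-≥ H ∂≥ξ₃ S restricted }) ,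
  ((Triangle G k x₀ , triangle , card-triangle G k x₀ , triangle-connected G k x₀ , size≡ξ₃) ,
   λ { _ (X , X? , card≡3 , _ , refl) → triple X? card≡3 })
  where
  H = G ⊠ K n
  open Graph G using (vertices; δ)
  triangle = triangle? G k x₀
  ξ₃ = 3 * ((1 + δ) * n ∸ 3)
  1≤δ : 1 ≤ δ
  1≤δ = δ-positive n δ n≥4 (≤-trans bound (m⊓n≤m _ _))
  size≡ξ₃ : EdgeSubset.size (∂ H triangle) ≡ ξ₃
  size≡ξ₃ = trans (size-∂-triangle G k x₀) (cong (λ d → 3 * ((1 + d) * n ∸ 3)) degree≡δ)
  ∂≥ξ₃ : {X : Pred (Graph.Vertex H) 0ℓ} (X? : U.Decidable X) → 3 ≤ Graph.card H X? → 3 ≤ Graph.card H (¬? ∘ X?) →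
         ξ₃ ≤ EdgeSubset.size (∂ H X?)
  ∂≥ξ₃ X? 3≤X 3≤Xᶜ = subst (ξ₃ ≤_) (sym (size-∂-⊠ G n X?))
    (cutWeight-≥-ξ₃ G mec n≥4 1≤δ (layer-¬ G n X?)
      (subst (3 ≤_) (card-layer G n X?) 3≤X) (subst (3 ≤_) (card-layer G n (¬? ∘ X?)) 3≤Xᶜ)
      (≤-trans (≤-reflexive (sym (ξ₃-formula n δ))) (≤-trans bound (m⊓n≤n (n ^ 2 * δ) _))))
  triple : {X : Pred (Graph.Vertex H) 0ℓ} (X? : U.Decidable X) → Graph.card H X? ≡ 3 → ξ₃ ≤ EdgeSubset.size (∂ H X?)
  -- The count `s * ((1 + δ) * n ∸ s)` of outside neighbours equals `ξ₃` at `s = 3`.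
  triple X? card≡3 = subst (ξ₃ ≤_) (sym (size-∂-⊠ G n X?)) (subst (λ s → s * ((1 + δ) * n ∸ s) ≤ cutWeight G (layer G n X?) (layer G n (¬? ∘ X?)))
    (trans (sym (card-layer G n X?)) card≡3) (cutWeight-≥ G (ballSum-≥-∸ G (layer-¬ G n X?))))
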